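{- For every positive integer $n$, $\hat{r}_c(nK_2,C_4)\le \lfloor (9n-1)/2\rfloor$.
   Context: All graphs are finite and simple. $nK_2$ denotes a matching with $n$ edges, and $C_4$ denotes the cycle on 4 vertices. For graphs $G, G_1, G_2$, write $G\to(G_1,G_2)$ if for every colouring of the edges of $G$ with red and blue, $G$ contains either a red copy of $G_1$ (all edges red) or a blue copy of $G_2$ (all edges blue). The connected size Ramsey number $\hat{r}_c(G_1,G_2)$ is the minimum number of edges of a connected graph $G$ with $G\to(G_1,G_2)$. -}

module Defs where

open import Data.Nat using (ℕ; _<_; _≤_; _*_; _∸_; _/_)
open import Data.Fin as Fin using (Fin)
open import Data.Bool using (Bool; true; false)
open import Data.Product using (_×_; _,_; proj₁; proj₂; Σ; ∃)
open import Data.Sum using (_⊎_)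
open import Data.List using (List; length)
open import Data.List.Membership.Propositional using (_∈_)
open import Data.List.Relation.Unary.All using (All)
open import Data.List.Relation.Unary.Unique.Propositional using (Unique)
open import Relation.Binary.PropositionalEquality using (_≡_; _≢_)

-- A finite simple graph: vertex set Fin V, edge set given as a duplicate-free
-- list of pairs (u , w) with u < w (so each edge {u,w} is listed exactly once,
-- and there are no loops). The number of edges is the length of the list.
record Graph : Set where
  field
    V     : ℕ
    E     : List (Fin V × Fin V)
    ordered : All (λ e → proj₁ e Fin.< proj₂ e) E
    nodup : Unique E
open Graph public

size : Graph → ℕ
size G = length (E G)

Adj : (G : Graph) → Fin (V G) → Fin (V G) → Set
Adj G u w = ((u , w) ∈ E G) ⊎ ((w , u) ∈ E G)

data Reach (G : Graph) : Fin (V G) → Fin (V G) → Set where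
  here : ∀ {u} → Reach G u u
  step : ∀ {u w x} → Adj G u w → Reach G w x → Reach G u x

Connected : Graph → Set
Connected G = ∀ u w → Reach G u w

-- red/blue colourings of the edges (true = red, false = blue); a colour is
-- assigned to each listed edge (u , w) with u < w.
Colouring : Graph → Set
Colouring G = Fin (V G) × Fin (V G) → Bool

ColEdge : (G : Graph) → Colouring G → Bool → Fin (V G) → Fin (V G) → Set
ColEdge G c b u w =
  ((u , w) ∈ E G × c (u , w) ≡ b) ⊎ ((w , u) ∈ E G × c (w , u) ≡ b)

RedMatching : (G : Graph) → Colouring G → ℕ → Set
RedMatching G c n =
  Σ (Fin n → Fin (V G) × Fin (V G)) λ f →
    (∀ i → ColEdge G c true (proj₁ (f i)) (proj₂ (f i))) ×
    (∀ i j → i ≢ j →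
        (proj₁ (f i) ≢ proj₁ (f j)) × (proj₁ (f i) ≢ proj₂ (f j)) ×
        (proj₂ (f i) ≢ proj₁ (f j)) × (proj₂ (f i) ≢ proj₂ (f j)))

BlueC4 : (G : Graph) → Colouring G → Set
BlueC4 G c =
  Σ (Fin (V G)) λ a → Σ (Fin (V G)) λ b → Σ (Fin (V G)) λ x → Σ (Fin (V G)) λ d →
    (a ≢ b) × (a ≢ x) × (a ≢ d) × (b ≢ x) × (b ≢ d) × (x ≢ d) ×
    ColEdge G c false a b × ColEdge G c false b x ×
    ColEdge G c false x d × ColEdge G c false d a

Arrows : Graph → ℕ → Set
Arrows G n = (c : Colouring G) → RedMatching G c n ⊎ BlueC4 G c

ConnSizeRamseyLe : ℕ → ℕ → Set
ConnSizeRamseyLe n k = Σ Graph λ G → Connected G × size G ≤ k × Arrows G n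

{-# OPTIONS --safe #-}

-- A four-cycle arrows (K₂, C₄), and K₃,₃ minus an edge, which has 8 edges, arrows (2K₂, C₄):
-- every vertex of it is avoided by some four-cycle, so if there is no blue C₄ then the red
-- edges are not all at one vertex, and as the graph is bipartite they do not form a triangle
-- either; hence two of them are disjoint.  Joining two connected graphs by a bridge adds the
-- sizes of the guaranteed red matchings at the cost of one edge, so adding two to n costs
-- 8 + 1 = 9 edges.
module Submission where

open import Defs
open import Data.Bool using (Bool; true; false; not)
open import Data.Bool.Properties as Bool using (¬-not; not-¬; not-injective)
open import Data.Empty using (⊥; ⊥-elim)
open import Data.Fin as Fin using (Fin; zero; suc; toℕ; #_; _↑ˡ_; _↑ʳ_; splitAt)
open import Data.Fin.Properties as Fin using (_≟_; _<?_; ↑ˡ-injective; ↑ʳ-injective; join-splitAt; toℕ-↑ˡ; toℕ-↑ʳ; toℕ<n)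
open import Data.List using (List; []; _∷_; _++_; map)
open import Data.List.Membership.Propositional using (_∈_)
open import Data.List.Membership.Propositional.Properties using (∈-map⁺; ∈-map⁻; ∈-++⁺ˡ; ∈-++⁺ʳ; ∈-++⁻)
open import Data.List.Properties using (length-++; length-map)
open import Data.List.Relation.Unary.All as All using (All; []; _∷_; all?)
import Data.List.Relation.Unary.All.Properties as All
open import Data.List.Relation.Unary.Any using (here; there)
import Data.List.Relation.Unary.AllPairs as AllPairs
import Data.List.Relation.Unary.Unique.Propositional.Properties as Unique
open import Data.Nat using (ℕ; suc; _+_; _≤_; _*_; _∸_; _/_; z≤n; s≤s)
open import Data.Nat.DivMod using (+-distrib-/-∣ˡ)
open import Data.Nat.Divisibility using (divides-refl)
open import Data.Nat.Properties as ℕ using (≤-refl; ≤-reflexive)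
open import Data.Product using (_×_; _,_; proj₁; proj₂; Σ; ∃; ∃₂)
open import Data.Product.Properties using (,-injectiveˡ; ,-injectiveʳ; ≡-dec)
open import Data.Sum using (_⊎_; inj₁; inj₂; swap; [_,_]′)
open import Data.Unit using (⊤)
open import Function using (_∘_)
open import Function.Definitions using (Injective)
open import Relation.Binary.PropositionalEquality using (_≡_; _≢_; refl; sym; trans; cong; cong₂; subst; ≢-sym)
open import Relation.Nullary using (Dec; does; yes; no; ¬?; _×-dec_; _⊎-dec_; from-yes)
open import Relation.Nullary.Decidable using (True; toWitness)

-- Adjacency and reachability

adj? : (G : Graph) (u w : Fin (V G)) → Dec (Adj G u w)
adj? G u w = ((u , w) ∈? E G) ⊎-dec ((w , u) ∈? E G)
  where open import Data.List.Membership.DecPropositional (≡-dec _≟_ _≟_) using (_∈?_)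

Reach-trans : ∀ {G u v w} → Reach G u v → Reach G v w → Reach G u w
Reach-trans here       q = q
Reach-trans (step e p) q = step e (Reach-trans p q)

Reach-sym : ∀ {G u v} → Reach G u v → Reach G v u
Reach-sym here       = here
Reach-sym (step e p) = Reach-trans (Reach-sym p) (step (swap e) here)

reachable-from-root⇒Connected : ∀ {G} r → (∀ v → Reach G r v) → Connected G
reachable-from-root⇒Connected r reach u w = Reach-trans (Reach-sym (reach u)) (reach w)

ColEdge-sym : ∀ G c {b u w} → ColEdge G c b u w → ColEdge G c b w u
ColEdge-sym G c = swap

ColEdge⇒Adj : ∀ G c {b u w} → ColEdge G c b u w → Adj G u w
ColEdge⇒Adj G c (inj₁ (e , _)) = inj₁ e
ColEdge⇒Adj G c (inj₂ (e , _)) = inj₂ e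

red-or-blue : ∀ G c {u w} → Adj G u w → ColEdge G c true u w ⊎ ColEdge G c false u w
red-or-blue G c {u} {w} (inj₁ e) with c (u , w)
... | true  = inj₁ (inj₁ (e , refl))
... | false = inj₂ (inj₁ (e , refl))
red-or-blue G c {u} {w} (inj₂ e) with c (w , u)
... | true  = inj₁ (inj₂ (e , refl))
... | false = inj₂ (inj₂ (e , refl))

-- Embeddings

mapPair : ∀ {A B : Set} → (A → B) → A × A → B × B
mapPair h (u , w) = h u , h w

mapPair-injective : ∀ {A B : Set} {h : A → B} → Injective _≡_ _≡_ h → Injective _≡_ _≡_ (mapPair h)
mapPair-injective inj eq = cong₂ _,_ (inj (,-injectiveˡ eq)) (inj (,-injectiveʳ eq))

-- `h-edge` speaks of listed pairs, so `mapPair h` preserves their orientation. Hence, under the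
-- pulled-back colouring `c ∘ mapPair h`, an edge of `G` has literally the colour that `c` gives to
-- its image.
module Embedding {G J : Graph} (h : Fin (V G) → Fin (V J))
                 (h-edge : ∀ {e} → e ∈ E G → mapPair h e ∈ E J) where

  Reach-map : ∀ {u w} → Reach G u w → Reach J (h u) (h w)
  Reach-map here              = here
  Reach-map (step (inj₁ e) p) = step (inj₁ (h-edge e)) (Reach-map p)
  Reach-map (step (inj₂ e) p) = step (inj₂ (h-edge e)) (Reach-map p)

  ColEdge-map : ∀ {c b u w} → ColEdge G (c ∘ mapPair h) b u w → ColEdge J c b (h u) (h w)
  ColEdge-map (inj₁ (e , q)) = inj₁ (h-edge e , q)
  ColEdge-map (inj₂ (e , q)) = inj₂ (h-edge e , q)

  BlueC4-map : Injective _≡_ _≡_ h → ∀ {c} → BlueC4 G (c ∘ mapPair h) → BlueC4 J c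
  BlueC4-map inj {c} (a , b , x , d , ab , ax , ad , bx , bd , xd , e₁ , e₂ , e₃ , e₄) =
    h a , h b , h x , h d ,
    ab ∘ inj , ax ∘ inj , ad ∘ inj , bx ∘ inj , bd ∘ inj , xd ∘ inj ,
    ColEdge-map {c} e₁ , ColEdge-map {c} e₂ , ColEdge-map {c} e₃ , ColEdge-map {c} e₄

-- Matchings

-- This unfolds to the clause on distinct indices in `RedMatching`, so its proofs serve there
-- without conversion.
DisjointEdges : ∀ {A : Set} → A × A → A × A → Set
DisjointEdges e e′ =
  (proj₁ e ≢ proj₁ e′) × (proj₁ e ≢ proj₂ e′) × (proj₂ e ≢ proj₁ e′) × (proj₂ e ≢ proj₂ e′)

DisjointEdges-sym : ∀ {A : Set} {e e′ : A × A} → DisjointEdges e e′ → DisjointEdges e′ e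
DisjointEdges-sym (p , q , r , s) = ≢-sym p , ≢-sym r , ≢-sym q , ≢-sym s

DisjointEdges-map : ∀ {A B : Set} {h : A → B} → Injective _≡_ _≡_ h →
                    ∀ {e e′} → DisjointEdges e e′ → DisjointEdges (mapPair h e) (mapPair h e′)
DisjointEdges-map inj (p , q , r , s) = p ∘ inj , q ∘ inj , r ∘ inj , s ∘ inj

red-edge⇒RedMatching : ∀ G c {u w} → ColEdge G c true u w → RedMatching G c 1
red-edge⇒RedMatching G c {u} {w} e =
  (λ _ → u , w) , (λ _ → e) , λ { zero zero i≢j → ⊥-elim (i≢j refl) }

disjoint-red-edges⇒RedMatching : ∀ G c {u v x y} → ColEdge G c true u v → ColEdge G c true x y →
                                 DisjointEdges (u , v) (x , y) → RedMatching G c 2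
disjoint-red-edges⇒RedMatching G c {u} {v} {x} {y} e e′ dis = f , red , disj
  where
  f : Fin 2 → Fin (V G) × Fin (V G)
  f zero    = u , v
  f (suc _) = x , y

  red : ∀ i → ColEdge G c true (proj₁ (f i)) (proj₂ (f i))
  red zero    = e
  red (suc _) = e′

  disj : ∀ i j → i ≢ j → DisjointEdges (f i) (f j)
  disj zero       zero       i≢j = ⊥-elim (i≢j refl)
  disj zero       (suc zero) _   = dis
  disj (suc zero) zero       _   = DisjointEdges-sym dis
  disj (suc zero) (suc zero) i≢j = ⊥-elim (i≢j refl)

-- Four-cycles

IsFourCycle : (G : Graph) (a b x d : Fin (V G)) → Set
IsFourCycle G a b x d =
  ((a ≢ b) × (a ≢ x) × (a ≢ d) × (b ≢ x) × (b ≢ d) × (x ≢ d)) ×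
  (Adj G a b × Adj G b x × Adj G x d × Adj G d a)

isFourCycle? : ∀ G a b x d → Dec (IsFourCycle G a b x d)
isFourCycle? G a b x d =
  (a ≢? b ×-dec a ≢? x ×-dec a ≢? d ×-dec b ≢? x ×-dec b ≢? d ×-dec x ≢? d) ×-dec
  (adj? G a b ×-dec adj? G b x ×-dec adj? G x d ×-dec adj? G d a)
  where
  infix 4 _≢?_
  _≢?_ : ∀ {n} (i j : Fin n) → Dec (i ≢ j)
  i ≢? j = ¬? (i ≟ j)

-- The predicate is `_≢ v` for a cycle that avoids `v`, and constantly `⊤` where any four-cycle will
-- do.
FourCycleIn : (G : Graph) → (Fin (V G) → Set) → Set
FourCycleIn G P = Σ _ λ a → Σ _ λ b → Σ _ λ x → Σ _ λ d →
  IsFourCycle G a b x d × (P a × P b × P x × P d)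

-- Either all four edges of the cycle are blue, or the first red one inherits `P` from its two ends
-- on the cycle.
blue-or-red-edge : ∀ G c {P} → FourCycleIn G P →
                   BlueC4 G c ⊎ ∃₂ λ u w → P u × P w × ColEdge G c true u w
blue-or-red-edge G c
  (a , b , x , d , ((ab , ax , ad , bx , bd , xd) , e₁ , e₂ , e₃ , e₄) , pa , pb , px , pd)
  with red-or-blue G c e₁ | red-or-blue G c e₂ | red-or-blue G c e₃ | red-or-blue G c e₄
... | inj₁ r | _      | _      | _      = inj₂ (a , b , pa , pb , r)
... | inj₂ _ | inj₁ r | _      | _      = inj₂ (b , x , pb , px , r)
... | inj₂ _ | inj₂ _ | inj₁ r | _      = inj₂ (x , d , px , pd , r)
... | inj₂ _ | inj₂ _ | inj₂ _ | inj₁ r = inj₂ (d , a , pd , pa , r)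
... | inj₂ s | inj₂ t | inj₂ u | inj₂ v =
  inj₁ (a , b , x , d , ab , ax , ad , bx , bd , xd , s , t , u , v)

fourCycle⇒Arrows-1 : ∀ G {P} → FourCycleIn G P → Arrows G 1
fourCycle⇒Arrows-1 G cyc c with blue-or-red-edge G c cyc
... | inj₁ blue                = inj₂ blue
... | inj₂ (_ , _ , _ , _ , r) = inj₁ (red-edge⇒RedMatching G c r)

-- A proper colouring of the vertices, that is, a bipartition; it is independent of the red and blue
-- edge colourings.
TwoColouring : (G : Graph) → (Fin (V G) → Bool) → Set
TwoColouring G side = All (λ e → side (proj₁ e) ≢ side (proj₂ e)) (E G)

module Bipartite (G : Graph) {side : Fin (V G) → Bool} (two : TwoColouring G side) where

  Adj⇒opposite-sides : ∀ {u w} → Adj G u w → side u ≡ not (side w)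
  Adj⇒opposite-sides (inj₁ e) = ¬-not (All.lookup two e)
  Adj⇒opposite-sides (inj₂ e) = ¬-not (≢-sym (All.lookup two e))

  TwoColouring⇒irreflexive : ∀ {u w} → Adj G u w → u ≢ w
  TwoColouring⇒irreflexive a refl = not-¬ refl (Adj⇒opposite-sides a)

  -- Both `v` and `x` lie opposite `u`, hence on one side, which contradicts their adjacency.
  TwoColouring⇒triangle-free : ∀ {u v x} → Adj G u v → Adj G v x → Adj G u x → ⊥
  TwoColouring⇒triangle-free uv vx ux = not-¬
    (not-injective (trans (sym (Adj⇒opposite-sides uv)) (Adj⇒opposite-sides ux)))
    (Adj⇒opposite-sides vx)

  -- A cycle avoiding `u` is blue or supplies a red edge that misses `u`. If that edge also misses
  -- `v`, it forms a matching with `uv`; otherwise it passes through `v` and is the edge `vx` of the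
  -- third outcome.
  red-edge-at : ∀ c {u v} → FourCycleIn G (_≢ u) → u ≢ v → ColEdge G c true u v →
                RedMatching G c 2 ⊎ BlueC4 G c ⊎ ∃ λ x → x ≢ u × ColEdge G c true v x
  red-edge-at c {u} {v} cyc u≢v uv with blue-or-red-edge G c cyc
  ... | inj₁ blue = inj₂ (inj₁ blue)
  ... | inj₂ (x , y , x≢u , y≢u , xy) with v ≟ x | v ≟ y
  ...   | yes refl | _        = inj₂ (inj₂ (y , y≢u , xy))
  ...   | no _     | yes refl = inj₂ (inj₂ (x , x≢u , ColEdge-sym G c xy))
  ...   | no v≢x   | no v≢y   =
    inj₁ (disjoint-red-edges⇒RedMatching G c uv xy (≢-sym x≢u , ≢-sym y≢u , v≢x , v≢y))

  avoiding-fourCycles⇒Arrows-2 : Fin (V G) → (∀ v → FourCycleIn G (_≢ v)) → Arrows G 2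
  -- `v₀` only selects some four-cycle, from which the first red edge `uv` is taken.
  avoiding-fourCycles⇒Arrows-2 v₀ cyc c with blue-or-red-edge G c (cyc v₀)
  ... | inj₁ blue = inj₂ blue
  ... | inj₂ (u , v , _ , _ , uv)
    with u≢v ← TwoColouring⇒irreflexive (ColEdge⇒Adj G c uv)
    with red-edge-at c (cyc u) u≢v uv | red-edge-at c (cyc v) (≢-sym u≢v) (ColEdge-sym G c uv)
  ...   | inj₁ m           | _                = inj₁ m
  ...   | inj₂ (inj₁ blue) | _                = inj₂ blue
  ...   | inj₂ (inj₂ _)    | inj₁ m           = inj₁ m
  ...   | inj₂ (inj₂ _)    | inj₂ (inj₁ blue) = inj₂ blue
  ...   | inj₂ (inj₂ (x , x≢u , vx)) | inj₂ (inj₂ (y , y≢v , uy)) =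
    -- As `vx` misses `u` and `uy` misses `v`, these edges could only meet in `x = y`, and then `u`,
    -- `v`, `x` would form a triangle.
    inj₁ (disjoint-red-edges⇒RedMatching G c vx uy (≢-sym u≢v , ≢-sym y≢v , x≢u , x≢y))
    where
    x≢y : x ≢ y
    x≢y refl = TwoColouring⇒triangle-free
      (ColEdge⇒Adj G c uv) (ColEdge⇒Adj G c vx) (ColEdge⇒Adj G c uy)

-- Joining two graphs by a bridge

↑ˡ≢↑ʳ : ∀ {m n} (i : Fin m) (j : Fin n) → i ↑ˡ n ≢ m ↑ʳ j
↑ˡ≢↑ʳ (suc i) j eq = ↑ˡ≢↑ʳ i j (Fin.suc-injective eq)

-- The vertices of `G` are numbered before those of `H`. The bridge is therefore correctly ordered
-- for any choice of `u` and `w`, and the edges of both copies keep their orientation.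
module Bridge (G H : Graph) (u : Fin (V G)) (w : Fin (V H)) where

  left : Fin (V G) → Fin (V G + V H)
  left i = i ↑ˡ V H

  right : Fin (V H) → Fin (V G + V H)
  right j = V G ↑ʳ j

  left-injective : Injective _≡_ _≡_ left
  left-injective = ↑ˡ-injective (V H) _ _

  right-injective : Injective _≡_ _≡_ right
  right-injective = ↑ʳ-injective (V G) _ _

  leftEdges rightEdges : List (Fin (V G + V H) × Fin (V G + V H))
  leftEdges  = map (mapPair left) (E G)
  rightEdges = map (mapPair right) (E H)

  left<right : ∀ i j → left i Fin.< right j
  left<right i j rewrite toℕ-↑ˡ i (V H) | toℕ-↑ʳ (V G) j = ℕ.<-≤-trans (toℕ<n i) (ℕ.m≤m+n (V G) _)

  left-mono-< : ∀ {i j} → i Fin.< j → left i Fin.< left j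
  left-mono-< {i} {j} i<j rewrite toℕ-↑ˡ i (V H) | toℕ-↑ˡ j (V H) = i<j

  right-mono-< : ∀ {i j} → i Fin.< j → right i Fin.< right j
  right-mono-< {i} {j} i<j rewrite toℕ-↑ʳ (V G) i | toℕ-↑ʳ (V G) j = ℕ.+-monoʳ-< (V G) i<j

  bridge∉ : ∀ {e} → e ∈ leftEdges ++ rightEdges → (left u , right w) ≢ e
  bridge∉ e∈ refl with ∈-++⁻ leftEdges e∈
  ... | inj₁ p with (_ , _ , eq) ← ∈-map⁻ (mapPair left) p  = ↑ˡ≢↑ʳ _ _ (sym (,-injectiveʳ eq))
  ... | inj₂ p with (_ , _ , eq) ← ∈-map⁻ (mapPair right) p = ↑ˡ≢↑ʳ _ _ (,-injectiveˡ eq)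

  leftEdges#rightEdges : ∀ {e} → e ∈ leftEdges × e ∈ rightEdges → ⊥
  leftEdges#rightEdges (p , q)
    with (_ , _ , refl) ← ∈-map⁻ (mapPair left) p
    with (_ , _ , eq)   ← ∈-map⁻ (mapPair right) q = ↑ˡ≢↑ʳ _ _ (,-injectiveˡ eq)

  graph : Graph
  graph = record
    { V       = V G + V H
    ; E       = (left u , right w) ∷ leftEdges ++ rightEdges
    ; ordered = left<right u w ∷ All.++⁺ (All.map⁺ (All.map left-mono-< (ordered G)))
                                         (All.map⁺ (All.map right-mono-< (ordered H)))
    ; nodup   = All.tabulate bridge∉ AllPairs.∷
                Unique.++⁺ (Unique.map⁺ (mapPair-injective left-injective) (nodup G))
                           (Unique.map⁺ (mapPair-injective right-injective) (nodup H))
                           leftEdges#rightEdges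
    }

  size-graph : size graph ≡ suc (size G + size H)
  size-graph = cong suc (trans (length-++ leftEdges)
    (cong₂ _+_ (length-map (mapPair left) (E G)) (length-map (mapPair right) (E H))))

  module Left  = Embedding {G} {graph} left (there ∘ ∈-++⁺ˡ ∘ ∈-map⁺ (mapPair left))
  module Right = Embedding {H} {graph} right (there ∘ ∈-++⁺ʳ leftEdges ∘ ∈-map⁺ (mapPair right))

  connected : Connected G → Connected H → Connected graph
  connected conG conH = reachable-from-root⇒Connected (left u) λ v →
    subst (Reach graph (left u)) (join-splitAt (V G) (V H) v) (reach (splitAt (V G) v))
    where
    reach : ∀ s → Reach graph (left u) (Fin.join (V G) (V H) s)
    reach (inj₁ i) = Left.Reach-map (conG u i)
    reach (inj₂ j) = step (inj₁ (here refl)) (Right.Reach-map (conH w j))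

  RedMatching-+ : ∀ {c m n} → RedMatching G (c ∘ mapPair left) m →
                  RedMatching H (c ∘ mapPair right) n → RedMatching graph c (m + n)
  RedMatching-+ {c} {m} {n} (f , f-red , f-dis) (g , g-red , g-dis) =
    fg ∘ splitAt m , fg-red ∘ splitAt m ,
    λ i j i≢j → fg-dis (splitAt m i) (splitAt m j)
      -- `splitAt` has the left inverse `join`, so distinct indices stay distinct after splitting.
      λ eq → i≢j (trans (sym (join-splitAt m n i)) (trans (cong (Fin.join m n) eq) (join-splitAt m n j)))
    where
    fg : Fin m ⊎ Fin n → Fin (V graph) × Fin (V graph)
    fg = [ mapPair left ∘ f , mapPair right ∘ g ]′

    fg-red : ∀ s → ColEdge graph c true (proj₁ (fg s)) (proj₂ (fg s))
    fg-red (inj₁ i) = Left.ColEdge-map {c} (f-red i)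
    fg-red (inj₂ j) = Right.ColEdge-map {c} (g-red j)

    left-right-disjoint : ∀ e e′ → DisjointEdges (mapPair left e) (mapPair right e′)
    left-right-disjoint e e′ = ↑ˡ≢↑ʳ _ _ , ↑ˡ≢↑ʳ _ _ , ↑ˡ≢↑ʳ _ _ , ↑ˡ≢↑ʳ _ _

    fg-dis : ∀ s t → s ≢ t → DisjointEdges (fg s) (fg t)
    fg-dis (inj₁ i) (inj₁ j) s≢t = DisjointEdges-map left-injective (f-dis i j (s≢t ∘ cong inj₁))
    fg-dis (inj₁ i) (inj₂ j) _   = left-right-disjoint (f i) (g j)
    fg-dis (inj₂ i) (inj₁ j) _   = DisjointEdges-sym (left-right-disjoint (f j) (g i))
    fg-dis (inj₂ i) (inj₂ j) s≢t = DisjointEdges-map right-injective (g-dis i j (s≢t ∘ cong inj₂))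

  -- Each copy is treated with the restricted colouring: a blue four-cycle in either one survives,
  -- and otherwise the two red matchings are combined.
  arrows : ∀ {m n} → Arrows G m → Arrows H n → Arrows graph (m + n)
  arrows arrG arrH c with arrG (c ∘ mapPair left) | arrH (c ∘ mapPair right)
  ... | inj₂ blue | _         = inj₂ (Left.BlueC4-map left-injective blue)
  ... | inj₁ _    | inj₂ blue = inj₂ (Right.BlueC4-map right-injective blue)
  ... | inj₁ p    | inj₁ q    = inj₁ (RedMatching-+ {c} p q)

-- A bridge needs an end in each graph. The all-red colouring provides one: a red matching of
-- positive size has a first edge, and a blue four-cycle would also name a vertex.
Arrows-suc⇒vertex : ∀ G {n} → Arrows G (suc n) → Fin (V G)
Arrows-suc⇒vertex G arr with arr (λ _ → true)
... | inj₁ (f , _) = proj₁ (f zero)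
... | inj₂ (a , _) = a

ConnSizeRamseyLe-+ : ∀ {m n k l} → ConnSizeRamseyLe (suc m) k → ConnSizeRamseyLe (suc n) l →
                     ConnSizeRamseyLe (suc m + suc n) (suc (k + l))
ConnSizeRamseyLe-+ (G , conG , sizeG , arrG) (H , conH , sizeH , arrH) =
  graph , connected conG conH ,
  ℕ.≤-trans (≤-reflexive size-graph) (s≤s (ℕ.+-mono-≤ sizeG sizeH)) ,
  arrows arrG arrH
  where open Bridge G H (Arrows-suc⇒vertex G arrG) (Arrows-suc⇒vertex H arrH)

-- The two building blocks

module _ {v : ℕ} where
  open import Data.List.Relation.Unary.Unique.DecPropositional (≡-dec (_≟_ {v}) (_≟_ {v})) using (unique?)

  -- For a concrete list both conditions are decided by evaluation, so the implicit `True` arguments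
  -- are filled in automatically.
  fromEdges : (es : List (Fin v × Fin v)) → {True (all? (λ e → proj₁ e <? proj₂ e) es)} →
              {True (unique? es)} → Graph
  fromEdges es {o} {u} = record { V = v ; E = es ; ordered = toWitness o ; nodup = toWitness u }

C₄ : Graph
C₄ = fromEdges {4} ((# 0 , # 1) ∷ (# 1 , # 2) ∷ (# 2 , # 3) ∷ (# 0 , # 3) ∷ [])

-- Parts {0, 1, 2} and {3, 4, 5}, with {0, 3} as the missing edge.
K₃₃-e : Graph
K₃₃-e = fromEdges {6}
  ( (# 0 , # 4) ∷ (# 0 , # 5) ∷ (# 1 , # 3) ∷ (# 1 , # 4)
  ∷ (# 1 , # 5) ∷ (# 2 , # 3) ∷ (# 2 , # 4) ∷ (# 2 , # 5) ∷ [])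

via : ∀ {G u x} w → {True (adj? G u w)} → Reach G w x → Reach G u x
via w {a} p = step (toWitness a) p

C₄-connected : Connected C₄
C₄-connected = reachable-from-root⇒Connected (# 0) λ where
  zero                   → here
  (suc zero)             → via (# 1) here
  (suc (suc zero))       → via (# 1) (via (# 2) here)
  (suc (suc (suc zero))) → via (# 3) here

K₃₃-e-connected : Connected K₃₃-e
K₃₃-e-connected = reachable-from-root⇒Connected (# 0) λ where
  zero                               → here
  (suc zero)                         → via (# 4) (via (# 1) here)
  (suc (suc zero))                   → via (# 4) (via (# 2) here)
  (suc (suc (suc zero)))             → via (# 4) (via (# 1) (via (# 3) here))
  (suc (suc (suc (suc zero))))       → via (# 4) here
  (suc (suc (suc (suc (suc zero))))) → via (# 5) here

C₄-arrows : Arrows C₄ 1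
C₄-arrows = fourCycle⇒Arrows-1 C₄ {P = λ _ → ⊤}
  (# 0 , # 1 , # 2 , # 3 , from-yes (isFourCycle? C₄ (# 0) (# 1) (# 2) (# 3)) , _)

K₃₃-e-arrows : Arrows K₃₃-e 2
K₃₃-e-arrows = Bipartite.avoiding-fourCycles⇒Arrows-2 K₃₃-e two (# 0) avoiding
  where
  side : Fin 6 → Bool
  side i = does (toℕ i ℕ.<? 3)

  two : TwoColouring K₃₃-e side
  two = from-yes (all? (λ e → ¬? (side (proj₁ e) Bool.≟ side (proj₂ e))) (E K₃₃-e))

  cycle : ∀ {v : Fin 6} a b x d → {True (isFourCycle? K₃₃-e a b x d)} →
          {True (¬? (a ≟ v) ×-dec ¬? (b ≟ v) ×-dec ¬? (x ≟ v) ×-dec ¬? (d ≟ v))} →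
          FourCycleIn K₃₃-e (_≢ v)
  cycle a b x d {p} {q} = a , b , x , d , toWitness p , toWitness q

  avoiding : ∀ v → FourCycleIn K₃₃-e (_≢ v)
  -- A four-cycle takes two vertices from each part and uses all edges between them, so every cycle
  -- here leaves out an end of the missing edge {0, 3}.
  avoiding zero                               = cycle (# 1) (# 3) (# 2) (# 4)
  avoiding (suc zero)                         = cycle (# 0) (# 4) (# 2) (# 5)
  avoiding (suc (suc zero))                   = cycle (# 0) (# 4) (# 1) (# 5)
  avoiding (suc (suc (suc zero)))             = cycle (# 0) (# 4) (# 1) (# 5)
  avoiding (suc (suc (suc (suc zero))))       = cycle (# 1) (# 3) (# 2) (# 5)
  avoiding (suc (suc (suc (suc (suc zero))))) = cycle (# 1) (# 3) (# 2) (# 4)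

-- The bound and the induction in steps of two

bound-step : ∀ n → suc (8 + (9 * suc n ∸ 1) / 2) ≡ (9 * (2 + suc n) ∸ 1) / 2
bound-step n = sym (trans (cong (λ k → (k ∸ 1) / 2) (ℕ.*-distribˡ-+ 9 2 (suc n)))
  -- Positivity of `9 * suc n` lets the truncated subtraction act on that summand alone; then 18,
  -- being even, leaves the floor as 9, which is the 8 edges of the block plus the bridge.
  (trans (cong (_/ 2) (ℕ.+-∸-assoc 18 {9 * suc n} {1} (s≤s z≤n)))
  (+-distrib-/-∣ˡ {18} (9 * suc n ∸ 1) {2} (divides-refl 9))))

theorem3 : (n : ℕ) → 1 ≤ n → ConnSizeRamseyLe n ((9 * n ∸ 1) / 2)
-- The bound evaluates to 4 here and to 8 in the next case, exactly the sizes of the two blocks.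
theorem3 1 _ = C₄ , C₄-connected , ≤-refl , C₄-arrows
theorem3 2 _ = K₃₃-e , K₃₃-e-connected , ≤-refl , K₃₃-e-arrows
theorem3 (suc (suc (suc n))) _ =
  subst (ConnSizeRamseyLe (3 + n)) (bound-step n)
    -- The recursive call is at `suc n` and so stays positive, as the choice of a bridge end
    -- requires; this is why both 1 and 2 are base cases.
    (ConnSizeRamseyLe-+ (K₃₃-e , K₃₃-e-connected , ≤-refl , K₃₃-e-arrows)
                        (theorem3 (suc n) (s≤s z≤n)))
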